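{- For every integer $l\ge 0$, $$E_{2l}=1-\frac{1}{2l+1}\sum_{j=1}^{l}\binom{2l+1}{2j}2^{2j}(2^{2j}-1)B_{2j}.$$
   Context: The Bernoulli numbers $B_n$ and the Euler numbers $E_n$ are defined by $\frac{x}{e^x-1}=\sum_{n=0}^{+\infty}\frac{B_n}{n!}x^n$ and $\frac{2}{e^x+e^{ -x}}=\sum_{n=0}^{+\infty}\frac{E_n}{n!}x^n$. An empty sum (such as $\sum_{j=1}^{0}$) equals $0$. -}

module Defs where

open import Data.Fin.Base using (Fin; zero; suc; toℕ)
open import Data.Integer.Base as ℤ using (ℤ; +_; 1ℤ; -1ℤ)
import Data.Integer.Properties as ℤ
open import Data.Nat.Base as ℕ using (ℕ; zero; suc; _∸_; _!)
open import Data.Nat.Properties using (_!≢0) renaming (+-identityʳ to ℕ-+-identityʳ)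
open import Data.Rational.Base
open import Data.Rational.Properties
import Data.Rational.Unnormalised.Base as ℚᵘ
import Data.Rational.Unnormalised.Properties as ℚᵘ
open import Data.Vec.Base using (Vec; []; _∷_; lookup)
open import Relation.Binary.PropositionalEquality

open import Algebra.Properties.CommutativeMonoid.Sum +-0-commutativeMonoid
  using (sum-syntax; sum⁺-syntax; sum-cong-≗)

fromℕ : ℕ → ℚ
fromℕ n = + n / 1

∑₁ : ℕ → (ℕ → ℚ) → ℚ
∑₁ l f = ∑[ i < l ] f (suc (toℕ i))

syntax ∑₁ l (λ j → t) = ∑[1≤ j ≤ l ] t

infix 10 ∑₁

------------------------------------------------------------------------
-- Formal power series over ℚ, given by their coefficients and compared
-- by pointwise equality _≗_

Series : Set
Series = ℕ → ℚ

const : ℚ → Series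
const c zero    = c
const c (suc _) = 0ℚ

X : Series
X zero    = 0ℚ
X (suc n) = const 1ℚ n

infixl 6 _⊕_ _⊖_
infixl 7 _⊛_

_⊕_ _⊖_ _⊛_ : Series → Series → Series
(f ⊕ g) n = f n + g n
(f ⊖ g) n = f n - g n
(f ⊛ g) n = ∑[ i ≤ n ] (f (toℕ i) * g (n ∸ toℕ i))

-- (f − f 0) / x
shift : Series → Series
shift f n = f (suc n)

-- e^(c x)
exp : ℤ → Series
exp c n = ((c ℤ.^ n) / (n !)) {{n !≢0}}

-- The exponential generating function ∑ aₙ xⁿ / n!
egf : (ℕ → ℚ) → Series
egf a n = a n * (1ℤ / (n !)) {{n !≢0}}

-- The quotient f / g, by long division. The quotient q is determined by
--   g₀ qₙ + ∑_{i<n} gᵢ₊₁ qₙ₋₁₋ᵢ = fₙ,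
-- and earlier f g n is the list qₙ₋₁ , … , q₀ of the coefficients before
-- the n-th one. See ⊘-correct.
module _ (f g : Series) .{{_ : NonZero (g 0)}} where

  infixl 7 _⊘_

  step : ∀ {n} → Vec ℚ n → ℚ
  step {n} qs = (f n - ∑[ i < n ] (g (suc (toℕ i)) * lookup qs i)) ÷ g 0

  earlier : ∀ n → Vec ℚ n
  earlier zero    = []
  earlier (suc n) = step (earlier n) ∷ earlier n

  _⊘_ : Series
  _⊘_ n = step (earlier n)

------------------------------------------------------------------------
-- Bernoulli and Euler numbers: n! times the n-th coefficient of the
-- generating function

-- e^x − 1 is not invertible as a power series, so x / (e^x − 1) is
-- computed as 1 / ((e^x − 1) / x). See B-egf.
B : ℕ → ℚ
B n = fromℕ (n !) * (const 1ℚ ⊘ shift (exp 1ℤ ⊖ const 1ℚ)) n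

E : ℕ → ℚ
E n = fromℕ (n !) * (const (fromℕ 2) ⊘ (exp 1ℤ ⊕ exp -1ℤ)) n

------------------------------------------------------------------------
-- B and E satisfy the defining identities of the generating functions

lookup-earlier : ∀ f g .{{_ : NonZero (g 0)}} n (i : Fin n) →
                 lookup (earlier f g n) i ≡ (f ⊘ g) (n ∸ suc (toℕ i))
lookup-earlier f g (suc n) zero    = refl
lookup-earlier f g (suc n) (suc i) = lookup-earlier f g n i

⊘-correct : ∀ f g .{{_ : NonZero (g 0)}} → g ⊛ (f ⊘ g) ≗ f
⊘-correct f g n = begin
  g 0 * (f ⊘ g) n + ∑[ i < n ] (g (suc (toℕ i)) * (f ⊘ g) (n ∸ suc (toℕ i)))
    ≡⟨ cong (λ p → g 0 * (f ⊘ g) n + p) (sum-cong-≗ λ i → cong (g (suc (toℕ i)) *_) (lookup-earlier f g n i)) ⟨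
  g 0 * ((f n - s) * 1/ g 0) + s   ≡⟨ cong (_+ s) (*-comm (g 0) _) ⟩
  (f n - s) * 1/ g 0 * g 0 + s     ≡⟨ cong (_+ s) (*-assoc (f n - s) _ _) ⟩
  (f n - s) * (1/ g 0 * g 0) + s   ≡⟨ cong (λ p → (f n - s) * p + s) (*-inverseˡ (g 0)) ⟩
  (f n - s) * 1ℚ + s               ≡⟨ cong (_+ s) (*-identityʳ (f n - s)) ⟩
  (f n - s) + s                    ≡⟨ +-assoc (f n) (- s) s ⟩
  f n + (- s + s)                  ≡⟨ cong (λ p → f n + p) (+-inverseˡ s) ⟩
  f n + 0ℚ                         ≡⟨ +-identityʳ (f n) ⟩
  f n                              ∎
  where
  open ≡-Reasoning
  s = ∑[ i < n ] (g (suc (toℕ i)) * lookup (earlier f g n) i)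

⊛-congʳ : ∀ f {g h} → g ≗ h → f ⊛ g ≗ f ⊛ h
⊛-congʳ f g≗h n =
  sum-cong-≗ {suc n} λ i → cong (f (toℕ i) *_) (g≗h (n ∸ toℕ i))

fromℕ*1/ : ∀ m .{{_ : ℕ.NonZero m}} → fromℕ m * (1ℤ / m) ≡ 1ℚ
fromℕ*1/ (suc m) = toℚᵘ-injective (begin
  toℚᵘ (fromℕ (suc m) * (1ℤ / suc m))            ≈⟨ toℚᵘ-homo-* (fromℕ (suc m)) (1ℤ / suc m) ⟩
  toℚᵘ (fromℕ (suc m)) ℚᵘ.* toℚᵘ (1ℤ / suc m)    ≈⟨ ℚᵘ.*-cong (toℚᵘ-fromℚᵘ (ℚᵘ.mkℚᵘ (+ suc m) 0))
                                                               (toℚᵘ-fromℚᵘ (ℚᵘ.mkℚᵘ 1ℤ m)) ⟩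
  ℚᵘ.mkℚᵘ (+ suc m) 0 ℚᵘ.* ℚᵘ.mkℚᵘ 1ℤ m          ≈⟨ ℚᵘ.*≡* (trans (ℤ.*-assoc (+ suc m) 1ℤ 1ℤ)
                                                             (trans (ℤ.*-identityʳ (+ suc m))
                                                             (trans (cong (λ k → + suc k) (sym (ℕ-+-identityʳ m)))
                                                                    (sym (ℤ.*-identityˡ _))))) ⟩
  ℚᵘ.1ℚᵘ                                         ∎)
  where open ℚᵘ.≃-Reasoning

egf-!* : ∀ q → egf (λ n → fromℕ (n !) * q n) ≗ q
egf-!* q n = begin
  fromℕ (n !) * q n * r      ≡⟨ cong (_* r) (*-comm (fromℕ (n !)) (q n)) ⟩
  q n * fromℕ (n !) * r      ≡⟨ *-assoc (q n) _ _ ⟩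
  q n * (fromℕ (n !) * r)    ≡⟨ cong (q n *_) (fromℕ*1/ (n !) {{n !≢0}}) ⟩
  q n * 1ℚ                   ≡⟨ *-identityʳ (q n) ⟩
  q n                        ∎
  where
  open ≡-Reasoning
  r = (1ℤ / (n !)) {{n !≢0}}

B-egf : (exp 1ℤ ⊖ const 1ℚ) ⊛ egf B ≗ X
B-egf n = trans (⊛-congʳ g (egf-!* q) n) (lemma n)
  where
  g = exp 1ℤ ⊖ const 1ℚ
  q = const 1ℚ ⊘ shift g
  lemma : g ⊛ q ≗ X
  lemma zero    = refl
  lemma (suc n) = trans (cong (_+ (shift g ⊛ q) n) (*-zeroˡ (q (suc n))))
                 (trans (+-identityˡ _) (⊘-correct (const 1ℚ) (shift g) n))

E-egf : (exp 1ℤ ⊕ exp -1ℤ) ⊛ egf E ≗ const (fromℕ 2)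
E-egf n = trans (⊛-congʳ g (egf-!* (const (fromℕ 2) ⊘ g)) n)
                (⊘-correct (const (fromℕ 2)) g n)
  where g = exp 1ℤ ⊕ exp -1ℤ

{-# OPTIONS --safe #-}

-- Write 𝓑 = x/(eˣ − 1) and 𝓔 = 2/(eˣ + e⁻ˣ). The exponential generating
-- function of bₙ = 2ⁿ(2ⁿ − 1)Bₙ is G(x) = 𝓑(4x) − 𝓑(2x) = −2x/(e²ˣ + 1), so
-- eˣ G = −x 𝓔. Hence G = −x e⁻ˣ 𝓔, and as 𝓔 is even, G(x) − G(−x) = −2x: the
-- only non-zero bₙ with n odd is b₁ = −1. The coefficient of x^(2l+1) in
-- eˣ G = −x 𝓔 is the theorem.

module Submission where

open import Defs
open import Data.Integer.Base using (1ℤ)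
open import Data.Nat.Base using (ℕ; suc; _^_) renaming (_*_ to _*ℕ_)
open import Data.Nat.Combinatorics using (_C_)
open import Data.Rational.Base using (1ℚ; _/_; _*_; _-_)
open import Relation.Binary.PropositionalEquality using (_≡_)

open import Algebra.Bundles using (CommutativeRing)
open import Algebra.Construct.Pointwise using (isAbelianGroup)
import Algebra.Properties.CommutativeSemiring.Binomial as Binomial
import Algebra.Properties.CommutativeSemiring.Exp as CommutativeExp
import Algebra.Properties.Semiring.Exp as Exp
import Algebra.Properties.Semiring.Mult as Mult
import Algebra.Properties.Semiring.Sum as Sum
import Algebra.Solver.Ring as RingSolver
open import Algebra.Solver.Ring.AlmostCommutativeRing
  using (fromCommutativeRing; _-Raw-AlmostCommutative⟶_)
open import Data.Fin.Base using (toℕ)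
open import Data.Fin.Properties using (toℕ<n)
open import Data.Integer.Base as ℤ using (ℤ; -1ℤ)
import Data.Integer.Properties as ℤ
open import Data.Nat.Base as ℕ using (zero; _≤_; _∸_; _!; s≤s⁻¹)
open import Data.Nat.Combinatorics using (nCk≡n!/k![n-k]!; nC1≡n)
open import Data.Nat.Combinatorics.Specification using ([n∸k]!k!∣n!)
open import Data.Nat.DivMod using (m/n*n≡m)
open import Data.Nat.Divisibility using (_∣_)
import Data.Nat.Properties as ℕ
open import Data.Product.Base using (_,_)
open import Data.Rational.Base using (ℚ; 0ℚ; ½; _+_; -_; fromℚᵘ; toℚᵘ)
open import Data.Rational.Properties
open import Data.Rational.Solver using (module +-*-Solver)
import Data.Rational.Unnormalised.Base as ℚᵘ
import Data.Rational.Unnormalised.Properties as ℚᵘ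
open import Data.Maybe.Base as Maybe using (Maybe)
open import Level using (0ℓ)
open import Relation.Binary.Consequences using (dec⇒weaklyDec)
open import Relation.Binary.PropositionalEquality
  using (_≗_; refl; sym; trans; cong; cong₂; subst; module ≡-Reasoning)
import Relation.Binary.Reasoning.Setoid as SetoidReasoning

private
  module ℚR = CommutativeRing +-*-commutativeRing

open Exp ℚR.semiring using () renaming (_^_ to _^ℚ_; ^-homo-* to ^ℚ-homo-*; ^-assocʳ to ^ℚ-assocʳ)
open CommutativeExp ℚR.commutativeSemiring using () renaming (^-distrib-* to ^ℚ-distrib-*)
open Mult ℚR.semiring using () renaming (_×_ to _×ℚ_)
open Sum ℚR.semiring using (sum-syntax; sum⁺-syntax; sum-cong-≗; ∑-distrib-+; *-distribˡ-sum; sum-replicate-zero)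
open +-*-Solver using (solve; _:=_; _:+_; _:*_; _:-_; :-_; con)

-- Embedding the integers into ℚ

fromℚᵘ-homo-* : ∀ p q → fromℚᵘ p * fromℚᵘ q ≡ fromℚᵘ (p ℚᵘ.* q)
fromℚᵘ-homo-* p q = toℚᵘ-injective (begin
  toℚᵘ (fromℚᵘ p * fromℚᵘ q)             ≈⟨ toℚᵘ-homo-* (fromℚᵘ p) (fromℚᵘ q) ⟩
  toℚᵘ (fromℚᵘ p) ℚᵘ.* toℚᵘ (fromℚᵘ q)   ≈⟨ ℚᵘ.*-cong (toℚᵘ-fromℚᵘ p) (toℚᵘ-fromℚᵘ q) ⟩
  p ℚᵘ.* q                               ≈⟨ toℚᵘ-fromℚᵘ (p ℚᵘ.* q) ⟨
  toℚᵘ (fromℚᵘ (p ℚᵘ.* q))               ∎)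
  where open ℚᵘ.≃-Reasoning

fromℚᵘ-homo-+ : ∀ p q → fromℚᵘ p + fromℚᵘ q ≡ fromℚᵘ (p ℚᵘ.+ q)
fromℚᵘ-homo-+ p q = toℚᵘ-injective (begin
  toℚᵘ (fromℚᵘ p + fromℚᵘ q)             ≈⟨ toℚᵘ-homo-+ (fromℚᵘ p) (fromℚᵘ q) ⟩
  toℚᵘ (fromℚᵘ p) ℚᵘ.+ toℚᵘ (fromℚᵘ q)   ≈⟨ ℚᵘ.+-cong (toℚᵘ-fromℚᵘ p) (toℚᵘ-fromℚᵘ q) ⟩
  p ℚᵘ.+ q                               ≈⟨ toℚᵘ-fromℚᵘ (p ℚᵘ.+ q) ⟨
  toℚᵘ (fromℚᵘ (p ℚᵘ.+ q))               ∎)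
  where open ℚᵘ.≃-Reasoning

fromℤ : ℤ → ℚ
fromℤ i = i / 1

fromℤ-homo-* : ∀ i j → fromℤ (i ℤ.* j) ≡ fromℤ i * fromℤ j
fromℤ-homo-* i j = sym (fromℚᵘ-homo-* (ℚᵘ.mkℚᵘ i 0) (ℚᵘ.mkℚᵘ j 0))

fromℤ-homo-+ : ∀ i j → fromℤ (i ℤ.+ j) ≡ fromℤ i + fromℤ j
fromℤ-homo-+ i j = begin
  fromℤ (i ℤ.+ j)                         ≡⟨ cong₂ (λ a b → fromℤ (a ℤ.+ b)) (ℤ.*-identityʳ i) (ℤ.*-identityʳ j) ⟨
  fromℤ (i ℤ.* 1ℤ ℤ.+ j ℤ.* 1ℤ)           ≡⟨ fromℚᵘ-homo-+ (ℚᵘ.mkℚᵘ i 0) (ℚᵘ.mkℚᵘ j 0) ⟨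
  fromℤ i + fromℤ j                       ∎
  where open ≡-Reasoning

fromℤ-homo-^ : ∀ i n → fromℤ (i ℤ.^ n) ≡ fromℤ i ^ℚ n
fromℤ-homo-^ i zero    = refl
fromℤ-homo-^ i (suc n) = trans (fromℤ-homo-* i (i ℤ.^ n)) (cong (fromℤ i *_) (fromℤ-homo-^ i n))

fromℕ-homo-* : ∀ m n → fromℕ (m *ℕ n) ≡ fromℕ m * fromℕ n
fromℕ-homo-* m n = trans (cong fromℤ (ℤ.pos-* m n)) (fromℤ-homo-* (ℤ.+ m) (ℤ.+ n))

fromℕ-homo-^ : ∀ m n → fromℕ (m ^ n) ≡ fromℕ m ^ℚ n
fromℕ-homo-^ m zero    = refl
fromℕ-homo-^ m (suc n) = trans (fromℕ-homo-* m (m ^ n)) (cong (fromℕ m *_) (fromℕ-homo-^ m n))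

/-*-1/ : ∀ i n .{{_ : ℕ.NonZero n}} → i / n ≡ fromℤ i * (1ℤ / n)
/-*-1/ i (suc n) = begin
  i / suc n                      ≡⟨ cong₂ (λ j m → fromℚᵘ (ℚᵘ.mkℚᵘ j m)) (ℤ.*-identityʳ i) (ℕ.+-identityʳ n) ⟨
  fromℚᵘ (ℚᵘ.mkℚᵘ i 0 ℚᵘ.* ℚᵘ.mkℚᵘ 1ℤ n)  ≡⟨ fromℚᵘ-homo-* (ℚᵘ.mkℚᵘ i 0) (ℚᵘ.mkℚᵘ 1ℤ n) ⟨
  fromℤ i * (1ℤ / suc n)         ∎
  where open ≡-Reasoning

-- The binomial theorem used for `𝐞-homo` multiplies by binomial coefficients through iterated
-- addition, while `egf-⊛` multiplies by their images in ℚ; this reconciles the two.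
×ℚ-fromℕ : ∀ n p → n ×ℚ p ≡ fromℕ n * p
×ℚ-fromℕ zero    p = sym (*-zeroˡ p)
×ℚ-fromℕ (suc n) p = begin
  p + n ×ℚ p               ≡⟨ cong (p +_) (×ℚ-fromℕ n p) ⟩
  p + fromℕ n * p          ≡⟨ cong (_+ fromℕ n * p) (*-identityˡ p) ⟨
  1ℚ * p + fromℕ n * p     ≡⟨ *-distribʳ-+ p 1ℚ (fromℕ n) ⟨
  (1ℚ + fromℕ n) * p       ≡⟨ cong (_* p) (fromℤ-homo-+ 1ℤ (ℤ.+ n)) ⟨
  fromℕ (suc n) * p        ∎
  where open ≡-Reasoning

1^n≡1 : ∀ n → 1ℚ ^ℚ n ≡ 1ℚ
1^n≡1 zero    = refl
1^n≡1 (suc n) = trans (*-identityˡ _) (1^n≡1 n)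

-- The ring of formal power series

0ₛ : Series
0ₛ _ = 0ℚ

neg : Series → Series
neg f n = - f n

⊛-cong : ∀ {f f′ g g′} → f ≗ f′ → g ≗ g′ → f ⊛ g ≗ f′ ⊛ g′
⊛-cong f≗f′ g≗g′ n = sum-cong-≗ {suc n} λ i → cong₂ _*_ (f≗f′ (toℕ i)) (g≗g′ (n ∸ toℕ i))

⊛-congˡ : ∀ h {f g} → f ≗ g → f ⊛ h ≗ g ⊛ h
⊛-congˡ h f≗g = ⊛-cong f≗g (λ _ → refl)

-- By definition a convolution unfolds at the constant term of its left factor. Unfolding at the
-- right factor instead is what makes the induction for commutativity close.
⊛-sucʳ : ∀ f g n → (f ⊛ g) (suc n) ≡ f (suc n) * g 0 + (f ⊛ shift g) n
⊛-sucʳ f g zero    = solve 2 (λ a b → a :+ (b :+ con 0ℚ) := b :+ (a :+ con 0ℚ)) refl (f 0 * g 1) (f 1 * g 0)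
⊛-sucʳ f g (suc n) = begin
  f 0 * g (2 ℕ.+ n) + (shift f ⊛ g) (suc n)
    ≡⟨ cong (f 0 * g (2 ℕ.+ n) +_) (⊛-sucʳ (shift f) g n) ⟩
  f 0 * g (2 ℕ.+ n) + (f (2 ℕ.+ n) * g 0 + (shift f ⊛ shift g) n)
    ≡⟨ solve 3 (λ a b c → a :+ (b :+ c) := b :+ (a :+ c)) refl (f 0 * g (2 ℕ.+ n)) (f (2 ℕ.+ n) * g 0) ((shift f ⊛ shift g) n) ⟩
  f (2 ℕ.+ n) * g 0 + (f 0 * g (2 ℕ.+ n) + (shift f ⊛ shift g) n) ∎
  where open ≡-Reasoning

⊛-comm : ∀ f g → f ⊛ g ≗ g ⊛ f
⊛-comm f g zero    = cong (_+ 0ℚ) (*-comm (f 0) (g 0))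
⊛-comm f g (suc n) = trans (cong₂ _+_ (*-comm (f 0) (g (suc n))) (⊛-comm (shift f) g n))
                           (sym (⊛-sucʳ g f n))

⊛-distribʳ : ∀ h f g → (f ⊕ g) ⊛ h ≗ (f ⊛ h) ⊕ (g ⊛ h)
⊛-distribʳ h f g n =
  trans (sum-cong-≗ {suc n} λ i → *-distribʳ-+ (h (n ∸ toℕ i)) (f (toℕ i)) (g (toℕ i)))
        (∑-distrib-+ {suc n} (λ i → f (toℕ i) * h (n ∸ toℕ i)) (λ i → g (toℕ i) * h (n ∸ toℕ i)))

⊛-distribˡ : ∀ h f g → h ⊛ (f ⊕ g) ≗ (h ⊛ f) ⊕ (h ⊛ g)
⊛-distribˡ h f g n = trans (⊛-comm h (f ⊕ g) n)
  (trans (⊛-distribʳ h f g n) (cong₂ _+_ (⊛-comm f h n) (⊛-comm g h n)))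

⊛-scalarˡ : ∀ c f g n → ((λ k → c * f k) ⊛ g) n ≡ c * (f ⊛ g) n
⊛-scalarˡ c f g n =
  trans (sum-cong-≗ {suc n} λ i → *-assoc c (f (toℕ i)) (g (n ∸ toℕ i)))
        (sym (*-distribˡ-sum {suc n} c (λ i → f (toℕ i) * g (n ∸ toℕ i))))

0ₛ-⊛ : ∀ f → 0ₛ ⊛ f ≗ 0ₛ
0ₛ-⊛ f n = trans (sum-cong-≗ {suc n} λ i → *-zeroˡ (f (n ∸ toℕ i))) (sum-replicate-zero (suc n))

const-⊛ : ∀ c f n → (const c ⊛ f) n ≡ c * f n
const-⊛ c f zero    = +-identityʳ (c * f 0)
const-⊛ c f (suc n) = trans (cong (c * f (suc n) +_) (0ₛ-⊛ f n)) (+-identityʳ _)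

-- Induction on the degree: `shift (f ⊛ g)` is by definition `f 0` times `shift g` plus
-- `shift f ⊛ g`, so distributivity and the induction hypothesis for `shift f` suffice.
⊛-assoc : ∀ f g h → (f ⊛ g) ⊛ h ≗ f ⊛ (g ⊛ h)
⊛-assoc f g h zero =
  solve 3 (λ a b c → (a :* b :+ con 0ℚ) :* c :+ con 0ℚ := a :* (b :* c :+ con 0ℚ) :+ con 0ℚ)
    refl (f 0) (g 0) (h 0)
⊛-assoc f g h (suc n) = begin
  (f 0 * g 0 + 0ℚ) * h (suc n) + (shift (f ⊛ g) ⊛ h) n
    ≡⟨ cong ((f 0 * g 0 + 0ℚ) * h (suc n) +_)
         (trans (⊛-distribʳ h (λ k → f 0 * g (suc k)) (shift f ⊛ g) n)
                (cong₂ _+_ (⊛-scalarˡ (f 0) (shift g) h n) (⊛-assoc (shift f) g h n))) ⟩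
  (f 0 * g 0 + 0ℚ) * h (suc n) + (f 0 * (shift g ⊛ h) n + (shift f ⊛ (g ⊛ h)) n)
    ≡⟨ solve 5 (λ a b c d e → (a :* b :+ con 0ℚ) :* c :+ (a :* d :+ e) := a :* (b :* c :+ d) :+ e)
         refl (f 0) (g 0) (h (suc n)) ((shift g ⊛ h) n) ((shift f ⊛ (g ⊛ h)) n) ⟩
  f 0 * (g 0 * h (suc n) + (shift g ⊛ h) n) + (shift f ⊛ (g ⊛ h)) n ∎
  where open ≡-Reasoning

seriesRing : CommutativeRing 0ℓ 0ℓ
seriesRing = record
  { Carrier = Series
  ; _≈_     = _≗_
  ; _+_     = _⊕_
  ; _*_     = _⊛_
  ; -_      = neg
  ; 0#      = 0ₛ
  ; 1#      = const 1ℚ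
  ; isCommutativeRing = record
    { isRing = record
      { +-isAbelianGroup = isAbelianGroup ℕ ℚR.+-isAbelianGroup
      ; *-cong           = ⊛-cong
      ; *-assoc          = ⊛-assoc
      ; *-identity       = 1-⊛ , λ f n → trans (⊛-comm f (const 1ℚ) n) (1-⊛ f n)
      ; distrib          = ⊛-distribˡ , ⊛-distribʳ
      }
    ; *-comm = ⊛-comm
    }
  }
  where
  1-⊛ : ∀ f → const 1ℚ ⊛ f ≗ f
  1-⊛ f n = trans (const-⊛ 1ℚ f n) (*-identityˡ (f n))

private
  module S = CommutativeRing seriesRing
  module ≗-Reasoning = SetoidReasoning S.setoid

-- With ℚ as coefficient ring, the solver for series computes with rational constants such as 2 and
-- -2 by itself.
const-homomorphism : ℚR.rawRing -Raw-AlmostCommutative⟶ fromCommutativeRing seriesRing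
const-homomorphism = record
  { ⟦_⟧    = const
  ; +-homo = λ { p q zero → refl ; p q (suc n) → refl }
  ; *-homo = λ p q n → sym (trans (const-⊛ p (const q) n) (*-const p q n))
  ; -‿homo = λ { p zero → refl ; p (suc n) → refl }
  ; 0-homo = λ { zero → refl ; (suc n) → refl }
  ; 1-homo = λ n → refl
  }
  where
  *-const : ∀ p q n → p * const q n ≡ const (p * q) n
  *-const p q zero    = refl
  *-const p q (suc n) = *-zeroʳ p

const-weaklyDec : ∀ p q → Maybe (const p ≗ const q)
const-weaklyDec p q = Maybe.map (λ { refl _ → refl }) (dec⇒weaklyDec _≟_ p q)

module SeriesSolver =
  RingSolver ℚR.rawRing (fromCommutativeRing seriesRing) const-homomorphism const-weaklyDec

open SeriesSolver using () renaming
  (solve to solveₛ; con to conₛ; _:=_ to _:=ₛ_; _:+_ to _:+ₛ_; _:*_ to _:*ₛ_; _:-_ to _:-ₛ_; :-_ to :-ₛ_)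

-- Exponential generating functions

-- The quotient defining the binomial coefficient is exact, so it can be multiplied out in ℕ.
nCk*[k!*[n∸k]!]≡n! : ∀ {n k} → k ≤ n → (n C k) *ℕ (k ! *ℕ (n ∸ k) !) ≡ n !
nCk*[k!*[n∸k]!]≡n! {n} {k} k≤n =
  trans (cong (_*ℕ (k ! *ℕ (n ∸ k) !)) (nCk≡n!/k![n-k]! k≤n))
        (m/n*n≡m {{k ℕ.!* (n ∸ k) !≢0}} (subst (_∣ n !) (ℕ.*-comm ((n ∸ k) !) (k !)) ([n∸k]!k!∣n! k≤n)))

-- Products of exponential generating functions are binomial convolutions, since `n !` divided by
-- `k !` and `(n ∸ k) !` is `n C k`.
egf-⊛ : ∀ a b n → fromℕ (n !) * (egf a ⊛ egf b) n ≡
        ∑[ i ≤ n ] (fromℕ (n C toℕ i) * (a (toℕ i) * b (n ∸ toℕ i)))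
egf-⊛ a b n = trans (*-distribˡ-sum {suc n} (fromℕ (n !)) (λ i → egf a (toℕ i) * egf b (n ∸ toℕ i)))
                    (sum-cong-≗ {suc n} λ i → term (toℕ i) (s≤s⁻¹ (toℕ<n i)))
  where
  open ≡-Reasoning
  1/_! : ℕ → ℚ
  1/ k ! = (1ℤ / (k !)) {{k ℕ.!≢0}}
  term : ∀ k → k ≤ n → fromℕ (n !) * (egf a k * egf b (n ∸ k)) ≡ fromℕ (n C k) * (a k * b (n ∸ k))
  term k k≤n = begin
    fromℕ (n !) * (egf a k * egf b m)
      ≡⟨ cong (λ z → fromℕ z * (egf a k * egf b m)) (nCk*[k!*[n∸k]!]≡n! k≤n) ⟨
    fromℕ ((n C k) *ℕ (k ! *ℕ m !)) * (egf a k * egf b m)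
      ≡⟨ cong (_* (egf a k * egf b m)) (trans (fromℕ-homo-* (n C k) _)
           (cong (fromℕ (n C k) *_) (fromℕ-homo-* (k !) (m !)))) ⟩
    fromℕ (n C k) * (fromℕ (k !) * fromℕ (m !)) * (egf a k * egf b m)
      ≡⟨ solve 7 (λ c p q x u y v → c :* (p :* q) :* ((x :* u) :* (y :* v))
                                  := c :* (x :* y) :* ((p :* u) :* (q :* v)))
           refl (fromℕ (n C k)) (fromℕ (k !)) (fromℕ (m !)) (a k) (1/ k !) (b m) (1/ m !) ⟩
    fromℕ (n C k) * (a k * b m) * ((fromℕ (k !) * 1/ k !) * (fromℕ (m !) * 1/ m !))
      ≡⟨ cong (fromℕ (n C k) * (a k * b m) *_)
           (cong₂ _*_ (fromℕ*1/ (k !) {{k ℕ.!≢0}}) (fromℕ*1/ (m !) {{m ℕ.!≢0}})) ⟩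
    fromℕ (n C k) * (a k * b m) * (1ℚ * 1ℚ)
      ≡⟨ *-identityʳ _ ⟩
    fromℕ (n C k) * (a k * b m) ∎
    where m = n ∸ k

fromℕ-moveˡ : ∀ m .{{_ : ℕ.NonZero m}} {p q} → fromℕ m * p ≡ q → p ≡ q * (1ℤ / m)
fromℕ-moveˡ m {p} {q} eq = begin
  p                            ≡⟨ *-identityʳ p ⟨
  p * 1ℚ                       ≡⟨ cong (p *_) (fromℕ*1/ m) ⟨
  p * (fromℕ m * (1ℤ / m))     ≡⟨ *-assoc p _ _ ⟨
  p * fromℕ m * (1ℤ / m)       ≡⟨ cong (_* (1ℤ / m)) (trans (*-comm p (fromℕ m)) eq) ⟩
  q * (1ℤ / m)                 ∎
  where open ≡-Reasoning

-- The series of e^(qx). Rational `q` keeps the family closed under `scale`, whose factor is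
-- rational.
𝐞 : ℚ → Series
𝐞 q = egf (q ^ℚ_)

exp≗𝐞 : ∀ i → exp i ≗ 𝐞 (fromℤ i)
exp≗𝐞 i n = trans (/-*-1/ (i ℤ.^ n) (n !) {{n ℕ.!≢0}})
                  (cong (_* (1ℤ / (n !)) {{n ℕ.!≢0}}) (fromℤ-homo-^ i n))

-- After multiplication by `n !`, the coefficient of degree `n` is the binomial theorem for `p + q`.
𝐞-homo : ∀ p q → 𝐞 p ⊛ 𝐞 q ≗ 𝐞 (p + q)
𝐞-homo p q n = fromℕ-moveˡ (n !) {{n ℕ.!≢0}} (begin
  fromℕ (n !) * (𝐞 p ⊛ 𝐞 q) n
    ≡⟨ egf-⊛ (p ^ℚ_) (q ^ℚ_) n ⟩
  ∑[ i ≤ n ] (fromℕ (n C toℕ i) * (p ^ℚ toℕ i * q ^ℚ (n ∸ toℕ i)))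
    ≡⟨ sum-cong-≗ {suc n} (λ i → ×ℚ-fromℕ (n C toℕ i) (p ^ℚ toℕ i * q ^ℚ (n ∸ toℕ i))) ⟨
  Binomial.binomialExpansion ℚR.commutativeSemiring p q n
    ≡⟨ Binomial.theorem ℚR.commutativeSemiring n p q ⟨
  (p + q) ^ℚ n ∎)
  where open ≡-Reasoning

𝐞0≗1 : 𝐞 0ℚ ≗ const 1ℚ
𝐞0≗1 zero    = refl
𝐞0≗1 (suc n) = trans (cong (_* r) (*-zeroˡ (0ℚ ^ℚ n))) (*-zeroˡ r)
  where r = (1ℤ / (suc n !)) {{suc n ℕ.!≢0}}

-- The substitution x ↦ c x

scale : ℚ → Series → Series
scale c f n = c ^ℚ n * f n

scale-cong : ∀ c {f g} → f ≗ g → scale c f ≗ scale c g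
scale-cong c f≗g n = cong (c ^ℚ n *_) (f≗g n)

scale-⊕ : ∀ c f g → scale c (f ⊕ g) ≗ scale c f ⊕ scale c g
scale-⊕ c f g n = *-distribˡ-+ (c ^ℚ n) (f n) (g n)

scale-neg : ∀ c f → scale c (neg f) ≗ neg (scale c f)
scale-neg c f n = sym (neg-distribʳ-* (c ^ℚ n) (f n))

scale-⊛ : ∀ c f g → scale c (f ⊛ g) ≗ scale c f ⊛ scale c g
scale-⊛ c f g n = trans (*-distribˡ-sum {suc n} (c ^ℚ n) (λ i → f (toℕ i) * g (n ∸ toℕ i)))
                        (sum-cong-≗ {suc n} λ i → term (toℕ i) (s≤s⁻¹ (toℕ<n i)))
  where
  term : ∀ k → k ≤ n → c ^ℚ n * (f k * g (n ∸ k)) ≡ scale c f k * scale c g (n ∸ k)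
  term k k≤n = trans
    (cong (_* (f k * g (n ∸ k)))
      (trans (cong (c ^ℚ_) (sym (ℕ.m+[n∸m]≡n k≤n))) (^ℚ-homo-* c k (n ∸ k))))
    (solve 4 (λ x y u v → x :* y :* (u :* v) := x :* u :* (y :* v)) refl
      (c ^ℚ k) (c ^ℚ (n ∸ k)) (f k) (g (n ∸ k)))

scale-const : ∀ c d → scale c (const d) ≗ const d
scale-const c d zero    = *-identityˡ d
scale-const c d (suc n) = *-zeroʳ (c ^ℚ suc n)

scale-X : ∀ c → scale c X ≗ const c ⊛ X
scale-X c n = trans (lemma n) (sym (const-⊛ c X n))
  where
  lemma : ∀ n → c ^ℚ n * X n ≡ c * X n
  lemma zero          = trans (*-zeroʳ 1ℚ) (sym (*-zeroʳ c))
  lemma (suc zero)    = cong (_* 1ℚ) (*-identityʳ c)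
  lemma (suc (suc n)) = trans (*-zeroʳ (c ^ℚ (2 ℕ.+ n))) (sym (*-zeroʳ c))

scale-𝐞 : ∀ c q → scale c (𝐞 q) ≗ 𝐞 (c * q)
scale-𝐞 c q n = trans (sym (*-assoc (c ^ℚ n) _ _))
  (cong (_* (1ℤ / (n !)) {{n ℕ.!≢0}}) (sym (^ℚ-distrib-* c q n)))

X-⊛ : ∀ f n → (X ⊛ f) (suc n) ≡ f n
X-⊛ f n = trans (cong₂ _+_ (*-zeroˡ (f (suc n))) (trans (const-⊛ 1ℚ f n) (*-identityˡ (f n))))
                (+-identityˡ (f n))

-- Cancellation takes the place of division by power series: an identity is first multiplied by 2 or
-- 2x, and these are then replaced by the products in `cosh-𝓔` or `scale-𝓑`.
X-cancelˡ : ∀ f g → X ⊛ f ≗ X ⊛ g → f ≗ g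
X-cancelˡ f g eq n = trans (sym (X-⊛ f n)) (trans (eq (suc n)) (X-⊛ g n))

2-cancelˡ : ∀ f g → const (fromℕ 2) ⊛ f ≗ const (fromℕ 2) ⊛ g → f ≗ g
2-cancelˡ f g eq n = begin
  f n                        ≡⟨ half (f n) ⟩
  ½ * (fromℕ 2 * f n)  ≡⟨ cong (½ *_) (trans (sym (const-⊛ (fromℕ 2) f n)) (trans (eq n) (const-⊛ (fromℕ 2) g n))) ⟩
  ½ * (fromℕ 2 * g n)  ≡⟨ half (g n) ⟨
  g n                        ∎
  where
  open ≡-Reasoning
  half : ∀ p → p ≡ ½ * (fromℕ 2 * p)
  half = solve 1 (λ p → p := con ½ :* (con (fromℕ 2) :* p)) refl

-- The generating functions of Bernoulli and Euler numbers

private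
  2ℚ 4ℚ -1ℚ : ℚ
  2ℚ  = fromℕ 2
  4ℚ  = fromℕ 4
  -1ℚ = - 1ℚ

𝓑 𝓔 : Series
𝓑 = egf B
𝓔 = egf E

G : Series
G = scale 4ℚ 𝓑 ⊖ scale 2ℚ 𝓑

𝐞1⊛𝐞-1≗1 : 𝐞 1ℚ ⊛ 𝐞 -1ℚ ≗ const 1ℚ
𝐞1⊛𝐞-1≗1 = S.trans (𝐞-homo 1ℚ -1ℚ) 𝐞0≗1

-- The substitution of cx for x in (eˣ - 1) 𝓑 = x, which is legitimate because `scale c` respects
-- sums and products.
scale-𝓑 : ∀ c → (𝐞 c ⊖ const 1ℚ) ⊛ scale c 𝓑 ≗ const c ⊛ X
scale-𝓑 c = begin
  (𝐞 c ⊖ const 1ℚ) ⊛ scale c 𝓑                ≈⟨ ⊛-congˡ (scale c 𝓑) 𝐞-1 ⟨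
  scale c (exp 1ℤ ⊖ const 1ℚ) ⊛ scale c 𝓑     ≈⟨ scale-⊛ c (exp 1ℤ ⊖ const 1ℚ) 𝓑 ⟨
  scale c ((exp 1ℤ ⊖ const 1ℚ) ⊛ 𝓑)           ≈⟨ scale-cong c B-egf ⟩
  scale c X                                    ≈⟨ scale-X c ⟩
  const c ⊛ X                                  ∎
  where
  open ≗-Reasoning
  𝐞-1 : scale c (exp 1ℤ ⊖ const 1ℚ) ≗ 𝐞 c ⊖ const 1ℚ
  𝐞-1 = begin
    scale c (exp 1ℤ ⊖ const 1ℚ)                  ≈⟨ scale-⊕ c (exp 1ℤ) (neg (const 1ℚ)) ⟩
    scale c (exp 1ℤ) ⊕ scale c (neg (const 1ℚ))  ≈⟨ S.+-cong (scale-cong c (exp≗𝐞 1ℤ)) (scale-neg c (const 1ℚ)) ⟩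
    scale c (𝐞 1ℚ) ⊖ scale c (const 1ℚ)          ≈⟨ S.+-cong (scale-𝐞 c 1ℚ) (S.-‿cong (scale-const c 1ℚ)) ⟩
    𝐞 (c * 1ℚ) ⊖ const 1ℚ                        ≈⟨ S.+-congʳ (λ n → cong (λ q → 𝐞 q n) (*-identityʳ c)) ⟩
    𝐞 c ⊖ const 1ℚ                               ∎

cosh-𝓔 : (𝐞 1ℚ ⊕ 𝐞 -1ℚ) ⊛ 𝓔 ≗ const 2ℚ
cosh-𝓔 = S.trans (⊛-congˡ 𝓔 (S.sym (S.+-cong (exp≗𝐞 1ℤ) (exp≗𝐞 -1ℤ)))) E-egf

-- Uniqueness of inverses: eˣ + e⁻ˣ is unchanged when x becomes -x, so its products with `𝓔` and
-- with 𝓔(-x) are both 2. Evaluating its product with both series in two ways gives 2 𝓔(-x) = 2 𝓔.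
𝓔-even : scale -1ℚ 𝓔 ≗ 𝓔
𝓔-even = 2-cancelˡ 𝓔⁻ 𝓔 (begin
  const 2ℚ ⊛ 𝓔⁻                           ≈⟨ ⊛-congˡ 𝓔⁻ cosh-𝓔 ⟨
  (𝐞 1ℚ ⊕ 𝐞 -1ℚ) ⊛ 𝓔 ⊛ 𝓔⁻               ≈⟨ rearrange (𝐞 1ℚ) (𝐞 -1ℚ) 𝓔 𝓔⁻ ⟩
  (𝐞 -1ℚ ⊕ 𝐞 1ℚ) ⊛ 𝓔⁻ ⊛ 𝓔               ≈⟨ ⊛-congˡ 𝓔 cosh-𝓔⁻ ⟩
  const 2ℚ ⊛ 𝓔                            ∎)
  where
  open ≗-Reasoning
  𝓔⁻ = scale -1ℚ 𝓔
  rearrange : ∀ p q f g → (p ⊕ q) ⊛ f ⊛ g ≗ (q ⊕ p) ⊛ g ⊛ f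
  rearrange = solveₛ 4 (λ p q f g → (p :+ₛ q) :*ₛ f :*ₛ g :=ₛ (q :+ₛ p) :*ₛ g :*ₛ f) S.refl
  cosh-𝓔⁻ : (𝐞 -1ℚ ⊕ 𝐞 1ℚ) ⊛ 𝓔⁻ ≗ const 2ℚ
  cosh-𝓔⁻ = begin
    (𝐞 -1ℚ ⊕ 𝐞 1ℚ) ⊛ 𝓔⁻
      ≈⟨ ⊛-congˡ 𝓔⁻ (S.+-cong (scale-𝐞 -1ℚ 1ℚ) (scale-𝐞 -1ℚ -1ℚ)) ⟨
    (scale -1ℚ (𝐞 1ℚ) ⊕ scale -1ℚ (𝐞 -1ℚ)) ⊛ 𝓔⁻
      ≈⟨ ⊛-congˡ 𝓔⁻ (scale-⊕ -1ℚ (𝐞 1ℚ) (𝐞 -1ℚ)) ⟨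
    scale -1ℚ (𝐞 1ℚ ⊕ 𝐞 -1ℚ) ⊛ 𝓔⁻
      ≈⟨ scale-⊛ -1ℚ (𝐞 1ℚ ⊕ 𝐞 -1ℚ) 𝓔 ⟨
    scale -1ℚ ((𝐞 1ℚ ⊕ 𝐞 -1ℚ) ⊛ 𝓔)
      ≈⟨ scale-cong -1ℚ cosh-𝓔 ⟩
    scale -1ℚ (const 2ℚ)
      ≈⟨ scale-const -1ℚ 2ℚ ⟩
    const 2ℚ ∎

-- With u = e²ˣ, P = 𝓑(4x) and Q = 𝓑(2x), the known identities are (u - 1) Q = 2x and (u² - 1) P =
-- 4x. Multiplying the claim by 2x = (u - 1) Q completes the factor u + 1 to u² - 1.
[𝐞2+1]G≗-2X : (𝐞 2ℚ ⊕ const 1ℚ) ⊛ G ≗ const (- 2ℚ) ⊛ X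
[𝐞2+1]G≗-2X = X-cancelˡ _ _ (2-cancelˡ _ _ (begin
  const 2ℚ ⊛ (X ⊛ ((u ⊕ 1ₛ) ⊛ (P ⊖ Q)))
    ≈⟨ S.*-assoc (const 2ℚ) X ((u ⊕ 1ₛ) ⊛ (P ⊖ Q)) ⟨
  (const 2ℚ ⊛ X) ⊛ ((u ⊕ 1ₛ) ⊛ (P ⊖ Q))
    ≈⟨ ⊛-congˡ ((u ⊕ 1ₛ) ⊛ (P ⊖ Q)) (scale-𝓑 2ℚ) ⟨
  ((u ⊖ 1ₛ) ⊛ Q) ⊛ ((u ⊕ 1ₛ) ⊛ (P ⊖ Q))
    ≈⟨ solveₛ 3 (λ u P Q → ((u :-ₛ conₛ 1ℚ) :*ₛ Q) :*ₛ ((u :+ₛ conₛ 1ℚ) :*ₛ (P :-ₛ Q))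
                :=ₛ Q :*ₛ ((u :*ₛ u :-ₛ conₛ 1ℚ) :*ₛ P) :-ₛ (u :+ₛ conₛ 1ℚ) :*ₛ Q :*ₛ ((u :-ₛ conₛ 1ℚ) :*ₛ Q)) S.refl u P Q ⟩
  Q ⊛ ((u ⊛ u ⊖ 1ₛ) ⊛ P) ⊖ (u ⊕ 1ₛ) ⊛ Q ⊛ ((u ⊖ 1ₛ) ⊛ Q)
    -- Here u² = e⁴ˣ makes `scale-𝓑 4ℚ` applicable. In the second product only one factor (u - 1) Q
    -- is replaced, so that the remaining Q can be collected with the first product.
    ≈⟨ S.+-cong (⊛-congʳ Q (S.trans (⊛-congˡ P (S.+-congʳ {neg 1ₛ} (𝐞-homo 2ℚ 2ℚ))) (scale-𝓑 4ℚ)))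
                (S.-‿cong (⊛-congʳ ((u ⊕ 1ₛ) ⊛ Q) (scale-𝓑 2ℚ))) ⟩
  Q ⊛ (const 4ℚ ⊛ X) ⊖ (u ⊕ 1ₛ) ⊛ Q ⊛ (const 2ℚ ⊛ X)
    -- The scalar identity is 4 - 2(u + 1) = -2(u - 1), which brings back the factor (u - 1) Q.
    ≈⟨ solveₛ 3 (λ u Q x → Q :*ₛ (conₛ 4ℚ :*ₛ x) :-ₛ (u :+ₛ conₛ 1ℚ) :*ₛ Q :*ₛ (conₛ 2ℚ :*ₛ x)
                :=ₛ conₛ (- 2ℚ) :*ₛ x :*ₛ ((u :-ₛ conₛ 1ℚ) :*ₛ Q)) S.refl u Q X ⟩
  const (- 2ℚ) ⊛ X ⊛ ((u ⊖ 1ₛ) ⊛ Q)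
    ≈⟨ ⊛-congʳ (const (- 2ℚ) ⊛ X) (scale-𝓑 2ℚ) ⟩
  const (- 2ℚ) ⊛ X ⊛ (const 2ℚ ⊛ X)
    ≈⟨ solveₛ 2 (λ k x → k :*ₛ x :*ₛ (conₛ 2ℚ :*ₛ x) :=ₛ conₛ 2ℚ :*ₛ (x :*ₛ (k :*ₛ x))) S.refl (const (- 2ℚ)) X ⟩
  const 2ℚ ⊛ (X ⊛ (const (- 2ℚ) ⊛ X)) ∎))
  where
  open ≗-Reasoning
  u 1ₛ P Q : Series
  u  = 𝐞 2ℚ
  1ₛ = const 1ℚ
  P  = scale 4ℚ 𝓑
  Q  = scale 2ℚ 𝓑

-- Writing the factor 2 as (eˣ + e⁻ˣ) 𝓔 and using eˣ (eˣ + e⁻ˣ) = e²ˣ + 1 reduces this to the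
-- preceding identity for `G`.
𝐞1⊛G≗-X𝓔 : 𝐞 1ℚ ⊛ G ≗ neg (X ⊛ 𝓔)
𝐞1⊛G≗-X𝓔 = 2-cancelˡ _ _ (begin
  const 2ℚ ⊛ (𝐞 1ℚ ⊛ G)
    ≈⟨ ⊛-congˡ (𝐞 1ℚ ⊛ G) cosh-𝓔 ⟨
  (𝐞 1ℚ ⊕ 𝐞 -1ℚ) ⊛ 𝓔 ⊛ (𝐞 1ℚ ⊛ G)
    ≈⟨ solveₛ 4 (λ p q f g → (p :+ₛ q) :*ₛ f :*ₛ (p :*ₛ g) :=ₛ f :*ₛ ((p :*ₛ p :+ₛ p :*ₛ q) :*ₛ g))
         S.refl (𝐞 1ℚ) (𝐞 -1ℚ) 𝓔 G ⟩
  𝓔 ⊛ ((𝐞 1ℚ ⊛ 𝐞 1ℚ ⊕ 𝐞 1ℚ ⊛ 𝐞 -1ℚ) ⊛ G)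
    ≈⟨ ⊛-congʳ 𝓔 (⊛-congˡ G (S.+-cong (𝐞-homo 1ℚ 1ℚ) 𝐞1⊛𝐞-1≗1)) ⟩
  𝓔 ⊛ ((𝐞 2ℚ ⊕ const 1ℚ) ⊛ G)
    ≈⟨ ⊛-congʳ 𝓔 [𝐞2+1]G≗-2X ⟩
  𝓔 ⊛ (const (- 2ℚ) ⊛ X)
    ≈⟨ solveₛ 2 (λ f x → f :*ₛ (conₛ (- 2ℚ) :*ₛ x) :=ₛ conₛ 2ℚ :*ₛ (:-ₛ (x :*ₛ f))) S.refl 𝓔 X ⟩
  const 2ℚ ⊛ neg (X ⊛ 𝓔) ∎)
  where open ≗-Reasoning

G≗-𝐞-1X𝓔 : G ≗ neg (𝐞 -1ℚ ⊛ (X ⊛ 𝓔))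
G≗-𝐞-1X𝓔 = begin
  G                                  ≈⟨ S.*-identityˡ G ⟨
  const 1ℚ ⊛ G                       ≈⟨ ⊛-congˡ G 𝐞1⊛𝐞-1≗1 ⟨
  𝐞 1ℚ ⊛ 𝐞 -1ℚ ⊛ G                   ≈⟨ solveₛ 3 (λ p q g → p :*ₛ q :*ₛ g :=ₛ q :*ₛ (p :*ₛ g)) S.refl (𝐞 1ℚ) (𝐞 -1ℚ) G ⟩
  𝐞 -1ℚ ⊛ (𝐞 1ℚ ⊛ G)                 ≈⟨ ⊛-congʳ (𝐞 -1ℚ) 𝐞1⊛G≗-X𝓔 ⟩
  𝐞 -1ℚ ⊛ neg (X ⊛ 𝓔)                ≈⟨ solveₛ 2 (λ p f → p :*ₛ (:-ₛ f) :=ₛ :-ₛ (p :*ₛ f)) S.refl (𝐞 -1ℚ) (X ⊛ 𝓔) ⟩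
  neg (𝐞 -1ℚ ⊛ (X ⊛ 𝓔))              ∎
  where open ≗-Reasoning

scale-1-G : scale -1ℚ G ≗ 𝐞 1ℚ ⊛ (X ⊛ 𝓔)
scale-1-G = begin
  scale -1ℚ G
    ≈⟨ scale-cong -1ℚ G≗-𝐞-1X𝓔 ⟩
  scale -1ℚ (neg (𝐞 -1ℚ ⊛ (X ⊛ 𝓔)))
    ≈⟨ scale-neg -1ℚ (𝐞 -1ℚ ⊛ (X ⊛ 𝓔)) ⟩
  neg (scale -1ℚ (𝐞 -1ℚ ⊛ (X ⊛ 𝓔)))
    ≈⟨ S.-‿cong (S.trans (scale-⊛ -1ℚ (𝐞 -1ℚ) (X ⊛ 𝓔))
         (⊛-cong (scale-𝐞 -1ℚ -1ℚ) (S.trans (scale-⊛ -1ℚ X 𝓔) (⊛-cong (scale-X -1ℚ) 𝓔-even)))) ⟩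
  neg (𝐞 1ℚ ⊛ (const -1ℚ ⊛ X ⊛ 𝓔))
    -- The sign in front cancels against the one from substituting -x in `X`; `𝓔` contributes none,
    -- being even.
    ≈⟨ solveₛ 3 (λ p x f → :-ₛ (p :*ₛ (conₛ -1ℚ :*ₛ x :*ₛ f)) :=ₛ p :*ₛ (x :*ₛ f)) S.refl (𝐞 1ℚ) X 𝓔 ⟩
  𝐞 1ℚ ⊛ (X ⊛ 𝓔) ∎
  where open ≗-Reasoning

G-odd-part : G ⊖ scale -1ℚ G ≗ const (- 2ℚ) ⊛ X
G-odd-part = begin
  G ⊖ scale -1ℚ G
    ≈⟨ S.+-cong G≗-𝐞-1X𝓔 (S.-‿cong scale-1-G) ⟩
  neg (𝐞 -1ℚ ⊛ (X ⊛ 𝓔)) ⊖ 𝐞 1ℚ ⊛ (X ⊛ 𝓔)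
    ≈⟨ solveₛ 4 (λ p q x f → :-ₛ (q :*ₛ (x :*ₛ f)) :-ₛ p :*ₛ (x :*ₛ f) :=ₛ :-ₛ ((p :+ₛ q) :*ₛ f :*ₛ x))
         S.refl (𝐞 1ℚ) (𝐞 -1ℚ) X 𝓔 ⟩
  neg ((𝐞 1ℚ ⊕ 𝐞 -1ℚ) ⊛ 𝓔 ⊛ X)
    ≈⟨ S.-‿cong (⊛-congˡ X cosh-𝓔) ⟩
  neg (const 2ℚ ⊛ X)
    ≈⟨ solveₛ 1 (λ x → :-ₛ (conₛ 2ℚ :*ₛ x) :=ₛ conₛ (- 2ℚ) :*ₛ x) S.refl X ⟩
  const (- 2ℚ) ⊛ X ∎
  where open ≗-Reasoning

-- Coefficients of `G` in odd degree

-1^odd≡-1 : ∀ k → -1ℚ ^ℚ suc (2 *ℕ k) ≡ -1ℚ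
-1^odd≡-1 k = cong (-1ℚ *_) (trans (sym (^ℚ-assocʳ -1ℚ 2 k)) (1^n≡1 k))

-- In odd degree the coefficient of G(x) - G(-x) is twice that of `G`. Stating the value through `X`
-- covers degree 1 and the vanishing higher degrees at once.
G-odd : ∀ k → G (suc (2 *ℕ k)) ≡ - X (suc (2 *ℕ k))
G-odd k = begin
  G n                            ≡⟨ solve 1 (λ g → g := con ½ :* (g :- con -1ℚ :* g)) refl (G n) ⟩
  ½ * (G n - -1ℚ * G n)          ≡⟨ cong (λ q → ½ * (G n - q * G n)) (-1^odd≡-1 k) ⟨
  ½ * (G n - -1ℚ ^ℚ n * G n)     ≡⟨ cong (½ *_) (trans (G-odd-part n) (const-⊛ (- 2ℚ) X n)) ⟩
  ½ * (- 2ℚ * X n)               ≡⟨ solve 1 (λ x → con ½ :* (con (- 2ℚ) :* x) := :- x) refl (X n) ⟩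
  - X n                          ∎
  where
  open ≡-Reasoning
  n = suc (2 *ℕ k)

-- Defined at odd indices too, so that the sequence has `G` as its exponential generating function
-- and the full binomial convolution is available.
b : ℕ → ℚ
b n = fromℕ (2 ^ n) * (fromℕ (2 ^ n) - 1ℚ) * B n

egf-b : egf b ≗ G
egf-b n = begin
  fromℕ (2 ^ n) * (fromℕ (2 ^ n) - 1ℚ) * B n * r
    ≡⟨ cong (λ t → t * (t - 1ℚ) * B n * r) (fromℕ-homo-^ 2 n) ⟩
  t * (t - 1ℚ) * B n * r
    ≡⟨ solve 3 (λ t x r → t :* (t :- con 1ℚ) :* x :* r := t :* t :* (x :* r) :- t :* (x :* r)) refl t (B n) r ⟩
  t * t * 𝓑 n - t * 𝓑 n
    ≡⟨ cong (λ s → s * 𝓑 n - t * 𝓑 n) (^ℚ-distrib-* 2ℚ 2ℚ n) ⟨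
  G n ∎
  where
  open ≡-Reasoning
  r = (1ℤ / (n !)) {{n ℕ.!≢0}}
  t = 2ℚ ^ℚ n

!*egf : ∀ a n → fromℕ (n !) * egf a n ≡ a n
!*egf a n = begin
  fromℕ (n !) * (a n * r)   ≡⟨ solve 3 (λ f x r → f :* (x :* r) := x :* (f :* r)) refl (fromℕ (n !)) (a n) r ⟩
  a n * (fromℕ (n !) * r)   ≡⟨ cong (a n *_) (fromℕ*1/ (n !) {{n ℕ.!≢0}}) ⟩
  a n * 1ℚ                  ≡⟨ *-identityʳ (a n) ⟩
  a n                       ∎
  where
  open ≡-Reasoning
  r = (1ℤ / (n !)) {{n ℕ.!≢0}}

b-odd : ∀ k → b (suc (2 *ℕ k)) ≡ fromℕ (suc (2 *ℕ k) !) * - X (suc (2 *ℕ k))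
b-odd k = trans (sym (!*egf b n)) (cong (fromℕ (n !) *_) (trans (egf-b n) (G-odd k)))
  where n = suc (2 *ℕ k)

b1≡-1 : b 1 ≡ -1ℚ
b1≡-1 = b-odd 0

b[3+2k]≡0 : ∀ k → b (3 ℕ.+ 2 *ℕ k) ≡ 0ℚ
b[3+2k]≡0 k = subst (λ n → b (suc n) ≡ 0ℚ) (ℕ.*-suc 2 k)
  (trans (b-odd (suc k)) (*-zeroʳ (fromℕ (suc (2 *ℕ suc k) !))))

-- The coefficient of degree m = 2l + 1 in eˣ G = -x 𝓔, times `m !`. The factor x lowers the degree
-- on the right to 2l, and m! = m · (2l)! leaves the factor m beside the Euler number.
binomial-b : ∀ l → ∑[ i ≤ suc (2 *ℕ l) ] (fromℕ (suc (2 *ℕ l) C toℕ i) * b (toℕ i)) ≡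
             - (fromℕ (suc (2 *ℕ l)) * E (2 *ℕ l))
binomial-b l = begin
  ∑[ i ≤ m ] (fromℕ (m C toℕ i) * b (toℕ i))
    -- Powers of 1 are inserted to exhibit the sum as the convolution of `b` with the sequence
    -- generating `𝐞 1ℚ`.
    ≡⟨ sum-cong-≗ {suc m} (λ i → cong (fromℕ (m C toℕ i) *_)
         (trans (cong (b (toℕ i) *_) (1^n≡1 (m ∸ toℕ i))) (*-identityʳ (b (toℕ i))))) ⟨
  ∑[ i ≤ m ] (fromℕ (m C toℕ i) * (b (toℕ i) * 1ℚ ^ℚ (m ∸ toℕ i)))
    ≡⟨ egf-⊛ b (1ℚ ^ℚ_) m ⟨
  fromℕ (m !) * (egf b ⊛ 𝐞 1ℚ) m
    ≡⟨ cong (fromℕ (m !) *_) (S.trans (⊛-congˡ (𝐞 1ℚ) egf-b) (S.trans (⊛-comm G (𝐞 1ℚ)) 𝐞1⊛G≗-X𝓔) m) ⟩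
  fromℕ (m !) * - (X ⊛ 𝓔) m
    ≡⟨ cong₂ (λ p q → p * - q) (fromℕ-homo-* m ((2 *ℕ l) !)) (X-⊛ 𝓔 (2 *ℕ l)) ⟩
  fromℕ m * fromℕ ((2 *ℕ l) !) * - 𝓔 (2 *ℕ l)
    ≡⟨ solve 3 (λ p q r → p :* q :* (:- r) := :- (p :* (q :* r))) refl (fromℕ m) (fromℕ ((2 *ℕ l) !)) (𝓔 (2 *ℕ l)) ⟩
  - (fromℕ m * (fromℕ ((2 *ℕ l) !) * 𝓔 (2 *ℕ l)))
    ≡⟨ cong (λ q → - (fromℕ m * q)) (!*egf E (2 *ℕ l)) ⟩
  - (fromℕ m * E (2 *ℕ l)) ∎
  where
  open ≡-Reasoning
  m = suc (2 *ℕ l)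

-- Reduction of the binomial sum to even indices

∑-even : ∀ l (f : ℕ → ℚ) → (∀ k → f (suc (2 *ℕ k)) ≡ 0ℚ) →
         ∑[ i < 2 *ℕ l ] f (toℕ i) ≡ ∑[ j < l ] f (2 *ℕ toℕ j)
∑-even zero    f odd≡0 = refl
∑-even (suc l) f odd≡0 = begin
  ∑[ i < 2 *ℕ suc l ] f (toℕ i)
    ≡⟨ cong (λ n → ∑[ i < n ] f (toℕ i)) (ℕ.*-suc 2 l) ⟩
  f 0 + (f 1 + ∑[ i < 2 *ℕ l ] f (2 ℕ.+ toℕ i))
    ≡⟨ cong (f 0 +_) (trans (cong (_+ ∑[ i < 2 *ℕ l ] f (2 ℕ.+ toℕ i)) (odd≡0 0)) (+-identityˡ _)) ⟩
  f 0 + ∑[ i < 2 *ℕ l ] f (2 ℕ.+ toℕ i)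
    ≡⟨ cong (f 0 +_) (∑-even l (λ n → f (2 ℕ.+ n))
         (λ k → trans (cong (λ n → f (suc n)) (sym (ℕ.*-suc 2 k))) (odd≡0 (suc k)))) ⟩
  f 0 + ∑[ j < l ] f (2 ℕ.+ 2 *ℕ toℕ j)
    ≡⟨ cong (f 0 +_) (sum-cong-≗ {l} (λ j → cong f (ℕ.*-suc 2 (toℕ j)))) ⟨
  f 0 + ∑[ j < l ] f (2 *ℕ suc (toℕ j)) ∎
  where open ≡-Reasoning

mainTheorem2 : (l : ℕ) →
    E (2 *ℕ l) ≡
    1ℚ - (1ℤ / suc (2 *ℕ l)) *
    (∑[1≤ j ≤ l ]
    (fromℕ (suc (2 *ℕ l) C (2 *ℕ j)) * fromℕ (2 ^ (2 *ℕ j))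
    * (fromℕ (2 ^ (2 *ℕ j)) - 1ℚ) * B (2 *ℕ j)))
mainTheorem2 l = begin
  E (2 *ℕ l)                  ≡⟨ fromℕ-moveˡ m mE≡m-S ⟩
  (fromℕ m - S) * r           ≡⟨ solve 3 (λ m s r → (m :- s) :* r := m :* r :- r :* s) refl (fromℕ m) S r ⟩
  fromℕ m * r - r * S         ≡⟨ cong (_- r * S) (fromℕ*1/ m) ⟩
  1ℚ - r * S                  ∎
  where
  open ≡-Reasoning
  m = suc (2 *ℕ l)
  r = 1ℤ / m
  F T : ℕ → ℚ
  F k = fromℕ (m C k) * b k
  T j = fromℕ (m C (2 *ℕ j)) * fromℕ (2 ^ (2 *ℕ j)) * (fromℕ (2 ^ (2 *ℕ j)) - 1ℚ) * B (2 *ℕ j)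
  S = ∑[1≤ j ≤ l ] T j
  F0≡0 : F 0 ≡ 0ℚ
  -- The factor 2⁰ - 1 in `b 0` computes to zero.
  F0≡0 = trans (cong (fromℕ (m C 0) *_) (*-zeroˡ (B 0))) (*-zeroʳ (fromℕ (m C 0)))
  -- This single surviving odd term becomes the leading 1 of the theorem after division by `m`.
  F1≡-m : F 1 ≡ - fromℕ m
  F1≡-m = trans (cong₂ (λ c q → fromℕ c * q) (nC1≡n m) b1≡-1)
                (solve 1 (λ m → m :* con -1ℚ := :- m) refl (fromℕ m))
  F-odd : ∀ k → F (3 ℕ.+ 2 *ℕ k) ≡ 0ℚ
  F-odd k = trans (cong (fromℕ (m C n) *_) (b[3+2k]≡0 k)) (*-zeroʳ (fromℕ (m C n)))
    where n = 3 ℕ.+ 2 *ℕ k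
  F-even : ∀ j → F (2 ℕ.+ 2 *ℕ j) ≡ T (suc j)
  F-even j = trans (cong F (sym (ℕ.*-suc 2 j)))
    (solve 4 (λ c p q e → c :* (p :* q :* e) := c :* p :* q :* e) refl
      (fromℕ (m C n)) (fromℕ (2 ^ n)) (fromℕ (2 ^ n) - 1ℚ) (B n))
    where n = 2 *ℕ suc j
  -- The left side is the sum over all indices up to m = 2l + 1 as it unfolds: splitting off 0 and 1
  -- leaves 2l terms, starting at index 2 and with the same parities, so `∑-even` applies.
  F-sum : F 0 + (F 1 + ∑[ i < 2 *ℕ l ] F (2 ℕ.+ toℕ i)) ≡ S - fromℕ m
  F-sum = begin
    F 0 + (F 1 + ∑[ i < 2 *ℕ l ] F (2 ℕ.+ toℕ i))
      ≡⟨ cong₂ (λ p q → p + (q + ∑[ i < 2 *ℕ l ] F (2 ℕ.+ toℕ i))) F0≡0 F1≡-m ⟩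
    0ℚ + (- fromℕ m + ∑[ i < 2 *ℕ l ] F (2 ℕ.+ toℕ i))
      ≡⟨ cong (λ q → 0ℚ + (- fromℕ m + q)) (trans (∑-even l (λ n → F (2 ℕ.+ n)) F-odd)
           (sum-cong-≗ {l} (λ j → F-even (toℕ j)))) ⟩
    0ℚ + (- fromℕ m + S)
      ≡⟨ solve 2 (λ m s → con 0ℚ :+ (:- m :+ s) := s :- m) refl (fromℕ m) S ⟩
    S - fromℕ m ∎
  mE≡m-S : fromℕ m * E (2 *ℕ l) ≡ fromℕ m - S
  mE≡m-S = begin
    fromℕ m * E (2 *ℕ l)         ≡⟨ solve 1 (λ p → p := :- (:- p)) refl (fromℕ m * E (2 *ℕ l)) ⟩
    - (- (fromℕ m * E (2 *ℕ l))) ≡⟨ cong -_ (trans (sym (binomial-b l)) F-sum) ⟩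
    - (S - fromℕ m)              ≡⟨ solve 2 (λ s m → :- (s :- m) := m :- s) refl S (fromℕ m) ⟩
    fromℕ m - S                  ∎
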